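{- Let $p,k$ be fixed positive integers. There exists $r_0$ such that for every $r\geq r_0$, every $r$-uniform hypergraph $\mathcal H$ with $\Delta_p(\mathcal H)\leq k$ admits a $p$-equitable orientation.
   Context: An $r$-uniform hypergraph $\mathcal H$ is a finite collection of $r$-element subsets (edges) of a finite vertex set $V(\mathcal H)$. An orientation of $\mathcal H$ assigns to every edge $S\in\mathcal H$ a bijection $\sigma_S:S\to[r]=\{1,\dots,r\}$ (a total order on $S$). For $U\subseteq V(\mathcal H)$ and $P\subseteq[r]$ with $|U|=|P|$, the degree of $U$ with respect to the positions $P$ is $d_P(U)=|\{S\in\mathcal H: U\subseteq S\text{ and }\sigma_S(U)=P\}|$. The orientation is $p$-equitable if $|d_P(U)-d_{P'}(U)|\leq 1$ for every $U\subseteq V(\mathcal H)$ and all $P,P'\subseteq[r]$ with $|U|=|P|=|P'|=p$. Finally $\Delta_p(\mathcal H)=\max_{U\subseteq V(\mathcal H),\,|U|=p}|\{S\in\mathcal H: U\subseteq S\}|$. -}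

module Defs where

open import Data.Nat using (ℕ; zero; suc; _≤_; ∣_-_∣)
open import Data.Bool using (Bool; true; false; _∧_; _∨_)
import Data.Bool as Bool
open import Data.Fin using (Fin; zero; suc)
import Data.Fin.Properties as FinP
open import Data.Fin.Subset using (Subset; _∈_; _⊆_; ∣_∣)
open import Data.Fin.Subset.Properties using (_⊆?_)
open import Data.Vec using (tabulate; lookup; count; allFin)
import Data.Vec.Properties as VecP

open import Data.Product using (Σ; ∃; _×_)
open import Relation.Binary.PropositionalEquality using (_≡_)
open import Relation.Nullary using (does; Dec; _×-dec_)

-- An r-uniform hypergraph on the vertex set Fin n with m edges.
-- Edges are pairwise distinct (a hypergraph is a set of r-subsets).
record Hypergraph (r : ℕ) : Set where
  field
    n       : ℕ
    m       : ℕ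
    edge    : Fin m → Subset n
    distinct : ∀ e f → edge e ≡ edge f → e ≡ f
    uniform : ∀ e → ∣ edge e ∣ ≡ r

open Hypergraph public

anyFin : {n : ℕ} → (Fin n → Bool) → Bool
anyFin {zero}  f = false
anyFin {suc n} f = f zero ∨ anyFin (λ i → f (suc i))

image : {n r : ℕ} → (Fin n → Fin r) → Subset n → Subset r
image σ U = tabulate (λ j → anyFin (λ u → lookup U u ∧ does (σ u FinP.≟ j)))

-- An orientation: for each edge S a bijection σ_S : S → [r]
-- (given by a map Fin n → Fin r whose restriction to S is bijective;
-- values outside S are irrelevant).
record Orientation {r : ℕ} (H : Hypergraph r) : Set where
  field
    σ    : Fin (m H) → Fin (n H) → Fin r
    inj  : ∀ e x y → x ∈ edge H e → y ∈ edge H e → σ e x ≡ σ e y → x ≡ y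
    surj : ∀ e (j : Fin r) → ∃ λ x → x ∈ edge H e × σ e x ≡ j

open Orientation public

deg : {r : ℕ} {H : Hypergraph r} → Orientation H → Subset (n H) → Subset r → ℕ
deg {r} {H} O U P =
  count (λ e → (U ⊆? edge H e) ×-dec VecP.≡-dec Bool._≟_ (image (σ O e) U) P)
        (allFin (m H))

Equitable : {r : ℕ} {H : Hypergraph r} → ℕ → Orientation H → Set
Equitable {r} {H} p O =
  ∀ (U : Subset (n H)) (P P′ : Subset r) → ∣ U ∣ ≡ p → ∣ P ∣ ≡ p → ∣ P′ ∣ ≡ p →
  ∣ deg O U P - deg O U P′ ∣ ≤ 1

codeg : {r : ℕ} (H : Hypergraph r) → Subset (n H) → ℕ
codeg H U = count (λ e → U ⊆? edge H e) (allFin (m H))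

MaxDegLe : {r : ℕ} → Hypergraph r → ℕ → ℕ → Set
MaxDegLe H p k = ∀ (U : Subset (n H)) → ∣ U ∣ ≡ p → codeg H U ≤ k

{-# OPTIONS --safe #-}
module Submission where

-- It suffices that no p-set U has the same image in two different edges, for then
-- all degrees d_P(U) are 0 or 1. Choose all bijections σ_S independently and
-- uniformly. The bad events fix, for two edges e ≠ f and p common vertices x,
-- the positions of x in e and in f (with equal image); each has probability about
-- r^(-2p). Two events conflict if they mention a common edge together with a
-- common vertex or a common position; as Δ_p ≤ k, an event conflicts with only
-- O(r^(2p-1)) others. Exchanging the positions of two vertices of an edge shows
-- that avoiding non-conflicting events does not make an event much more likely, so
-- the lopsided Lovász local lemma applies for large r. Probabilities are handled
-- by counting in the finite list Ω of all tuples of bijections.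

open import Defs
open import Data.Bool using (Bool; true; false; _∧_)
open import Data.Fin using (Fin; zero; suc; fromℕ<; punchIn)
import Data.Fin.Properties as FinP
open import Data.Fin.Permutation.Components using (transpose; transpose-inverse)
open import Data.Fin.Subset using (Subset; inside; outside; ∣_∣) renaming (_∈_ to _∈ₛ_; _⊆_ to _⊆ₛ_)
open import Data.Fin.Subset.Properties using (_∈?_; _⊆?_)
open import Data.List using (List; []; _∷_; _++_; length; filter; map; concatMap; cartesianProduct; cartesianProductWith; allFin; take)
import Data.List as List
open import Data.List.Properties using (length-++; length-map; length-tabulate; length-take; take-all; filter-all; filter-notAll)
open import Data.List.Membership.Propositional using (_∈_; lose; find)
open import Data.List.Membership.Propositional.Properties
open import Data.List.Relation.Binary.Sublist.Propositional using (_⊆_; ⊆-refl; ⊆-trans; _∷ʳ_) renaming (lookup to ⊆-lookup)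
import Data.List.Relation.Binary.Sublist.Propositional.Properties as SublistP
open import Data.List.Relation.Unary.All as All using (All; []; _∷_; all?)
import Data.List.Relation.Unary.All.Properties as AllP
open import Data.List.Relation.Unary.AllPairs as AllPairs using (AllPairs; []; _∷_)
import Data.List.Relation.Unary.AllPairs.Properties as AllPairsP
open import Data.List.Relation.Unary.Any as Any using (Any; here; there; any?)
open import Data.List.Relation.Unary.Any.Properties using (lookup-index)
open import Data.List.Relation.Unary.Unique.Propositional using (Unique)
import Data.List.Relation.Unary.Unique.Propositional.Properties as Unique
open import Data.Nat
open import Data.Nat.Properties
open import Data.Nat.Solver using (module +-*-Solver)
open import Data.Product using (∃; _×_; _,_; proj₁; proj₂)
open import Data.Sum using (_⊎_; inj₁; inj₂)
open import Data.Vec as Vec using (Vec; []; _∷_; lookup; tabulate; insertAt; removeAt)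
import Data.Vec.Properties as VecP
open import Function using (_∘_; case_of_)
open import Relation.Binary.PropositionalEquality
open import Relation.Nullary using (¬_; Dec; yes; no; contradiction; ¬?; _×-dec_; _⊎-dec_; _→-dec_; does)
open import Relation.Nullary.Decidable using (dec-true)
open import Relation.Unary using (Decidable)

-- Counting with duplicate-free lists

Unique⇒length≤ : {A : Set} {xs ys : List A} → Unique xs → (∀ {x} → x ∈ xs → x ∈ ys) → length xs ≤ length ys
Unique⇒length≤ [] _ = z≤n
Unique⇒length≤ {xs = x ∷ xs} (x∉xs ∷ xs!) sub with ∈-∃++ (sub (here refl))
... | us , vs , refl = subst (suc (length xs) ≤_) (sym eq) (s≤s (Unique⇒length≤ xs! sub′))
  where
  eq : length (us ++ x ∷ vs) ≡ suc (length (us ++ vs))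
  eq = trans (length-++ us) (trans (+-suc (length us) (length vs)) (cong suc (sym (length-++ us))))
  sub′ : ∀ {y} → y ∈ xs → y ∈ us ++ vs
  sub′ y∈ with ∈-++⁻ us (sub (there y∈))
  ... | inj₁ y∈us         = ∈-++⁺ˡ y∈us
  ... | inj₂ (here refl)  = contradiction refl (All.lookup x∉xs y∈)
  ... | inj₂ (there y∈vs) = ∈-++⁺ʳ us y∈vs

-- Injectivity is asked only on the entries of the list, because the swap map to which this is
-- applied is shown injective only on valid matrices.
Unique-map-on : {A B : Set} (f : A → B) {xs : List A} →
  (∀ {x y} → x ∈ xs → y ∈ xs → f x ≡ f y → x ≡ y) → Unique xs → Unique (map f xs)
Unique-map-on f inj xs! = AllPairsP.map⁺ (go inj xs!)
  where
  go : ∀ {xs} → (∀ {x y} → x ∈ xs → y ∈ xs → f x ≡ f y → x ≡ y) → Unique xs → AllPairs (λ x y → f x ≢ f y) xs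
  go inj [] = []
  go inj (x∉ ∷ xs!) =
    All.tabulate (λ y∈ fx≡fy → All.lookup x∉ y∈ (inj (here refl) (there y∈) fx≡fy)) ∷
    go (λ x∈ y∈ → inj (there x∈) (there y∈)) xs!

length-cartesianProductWith : {A B C : Set} (f : A → B → C) (xs : List A) (ys : List B) →
  length (cartesianProductWith f xs ys) ≡ length xs * length ys
length-cartesianProductWith f [] ys = refl
length-cartesianProductWith f (x ∷ xs) ys = trans (length-++ (map (f x) ys))
  (cong₂ _+_ (length-map (f x) ys) (length-cartesianProductWith f xs ys))

length-concatMap-≤ : {A B : Set} (f : A → List B) (xs : List A) {c : ℕ} →
  (∀ x → length (f x) ≤ c) → length (concatMap f xs) ≤ length xs * c
length-concatMap-≤ f [] h = z≤n
length-concatMap-≤ f (x ∷ xs) {c} h =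
  ≤-trans (≤-reflexive (length-++ (f x))) (+-mono-≤ (h x) (length-concatMap-≤ f xs h))

-- The lopsided Lovász local lemma in counting form

module LocalLemma
  {X E : Set} (Ω : List X)
  {Holds : E → X → Set} (holds? : ∀ b → Decidable (Holds b))
  where

  -- The probability of the predicate, scaled by `length Ω`. A bound on a conditional probability
  -- becomes a comparison of two counts with the denominators multiplied out.
  # : {P : X → Set} → Decidable P → ℕ
  # P? = length (filter P? Ω)

  Avoids : List E → X → Set
  Avoids B ω = All (λ b → ¬ Holds b ω) B

  avoids? : ∀ B → Decidable (Avoids B)
  avoids? B ω = all? (λ b → ¬? (holds? b ω)) B

  infixr 6 _∧?_
  _∧?_ : {P Q : X → Set} → Decidable P → Decidable Q → Decidable (λ ω → P ω × Q ω)
  (P? ∧? Q?) ω = P? ω ×-dec Q? ω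

  #-mono : {P Q : X → Set} (P? : Decidable P) (Q? : Decidable Q) → (∀ {ω} → P ω → Q ω) → # P? ≤ # Q?
  #-mono P? Q? P⇒Q = SublistP.length-mono-≤ (SublistP.filter⁺ P? Q? (λ { refl → P⇒Q }) (⊆-refl {x = Ω}))

  #-split : {P A : X → Set} (P? : Decidable P) (A? : Decidable A) →
    # P? ≤ # (P? ∧? ¬? ∘ A?) + # (A? ∧? P?)
  #-split P? A? = go Ω
    where
    go : ∀ ωs → length (filter P? ωs) ≤ length (filter (P? ∧? ¬? ∘ A?) ωs) + length (filter (A? ∧? P?) ωs)
    go [] = z≤n
    go (ω ∷ ωs) with P? ω | A? ω
    ... | yes _ | yes _ = ≤-trans (s≤s (go ωs)) (≤-reflexive (sym (+-suc _ _)))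
    ... | yes _ | no _  = s≤s (go ωs)
    ... | no _  | yes _ = go ωs
    ... | no _  | no _  = go ωs

  -- Members of `L` are excluded one at a time, each at the price of at most N/K elements of `Ω`.
  -- The factor `K` stays on the left to avoid division.
  union-bound : ∀ K N {P : X → Set} (P? : Decidable P) (L : List E) →
    (∀ {b} → b ∈ L → K * # (holds? b ∧? P?) ≤ N) →
    K * # P? ≤ K * # (P? ∧? avoids? L) + length L * N
  union-bound K N P? [] h =
    ≤-trans (*-monoʳ-≤ K (#-mono P? (P? ∧? avoids? []) (λ Pω → Pω , []))) (m≤m+n _ _)
  union-bound K N P? (b ∷ L) h = begin
    K * # P?                                                            ≤⟨ union-bound K N P? L (h ∘ there) ⟩
    K * # (P? ∧? avoids? L) + l                                         ≤⟨ +-monoˡ-≤ l (*-monoʳ-≤ K step) ⟩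
    K * (# (P? ∧? avoids? (b ∷ L)) + # (holds? b ∧? P?)) + l            ≡⟨ cong (_+ l) (*-distribˡ-+ K _ _) ⟩
    K * # (P? ∧? avoids? (b ∷ L)) + K * # (holds? b ∧? P?) + l          ≡⟨ +-assoc (K * # (P? ∧? avoids? (b ∷ L))) _ l ⟩
    K * # (P? ∧? avoids? (b ∷ L)) + (K * # (holds? b ∧? P?) + l)        ≤⟨ +-monoʳ-≤ (K * # (P? ∧? avoids? (b ∷ L))) (+-monoˡ-≤ l (h (here refl))) ⟩
    K * # (P? ∧? avoids? (b ∷ L)) + (N + l)                             ∎
    where
    open ≤-Reasoning
    l = length L * N
    step : # (P? ∧? avoids? L) ≤ # (P? ∧? avoids? (b ∷ L)) + # (holds? b ∧? P?)
    step = ≤-trans (#-split (P? ∧? avoids? L) (holds? b)) (+-mono-≤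
      (#-mono ((P? ∧? avoids? L) ∧? ¬? ∘ holds? b) (P? ∧? avoids? (b ∷ L)) (λ ((Pω , av) , ¬b) → Pω , ¬b ∷ av))
      (#-mono (holds? b ∧? P? ∧? avoids? L) (holds? b ∧? P?) (λ (hb , Pω , _) → hb , Pω)))

  module _
    {_∼_ : E → E → Set} (_∼?_ : ∀ b c → Dec (b ∼ c))
    (D : ℕ) .{{_ : NonZero D}} (𝓑 : List E)
    (degree : ∀ {b} → b ∈ 𝓑 → length (filter (b ∼?_) 𝓑) ≤ D)
    -- This takes the place of independence: an upper bound of 1/(4D) for `b`, conditional on
    -- avoiding events unrelated to it, is all that the induction uses.
    (lopsided : ∀ {b B} → b ∈ 𝓑 → All (λ c → ¬ b ∼ c) B →
      4 * D * # (holds? b ∧? avoids? B) ≤ # (avoids? B))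
    where

    -- Induction on the size of `B`, with `n` as fuel. Split `B` into the neighbours `B₁` of `b` and
    -- the rest `B₂`. Conditional on avoiding `B₂`, the event `b` has probability at most 1/(4D) by
    -- lopsidedness, while `B₁` is avoided with probability at least 1/2 by induction; the quotient
    -- is at most 1/(2D).
    conditional-≤ : ∀ n {b B} → length B < n → B ⊆ 𝓑 → b ∈ 𝓑 →
      2 * D * # (holds? b ∧? avoids? B) ≤ # (avoids? B)
    conditional-≤ (suc n) {b} {B} (s≤s |B|≤n) B⊆𝓑 b∈𝓑 = *-cancelˡ-≤ 2 (begin
      2 * (2 * D * # (holds? b ∧? avoids? B)) ≡⟨ solve 2 (λ d a → con 2 :* (con 2 :* d :* a) := con 4 :* d :* a) refl D _ ⟩
      4 * D * # (holds? b ∧? avoids? B)       ≤⟨ *-monoʳ-≤ (4 * D) (#-mono (holds? b ∧? avoids? B) (holds? b ∧? avoids? B₂)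
                                                   (λ (hb , av) → hb , All.tabulate (λ c∈ → All.lookup av (proj₁ (∈-filter⁻ far? c∈))))) ⟩
      4 * D * # (holds? b ∧? avoids? B₂)      ≤⟨ lopsided b∈𝓑 (AllP.all-filter far? B) ⟩
      s                                       ≤⟨ *-cancelˡ-≤ D (+-cancelʳ-≤ (D * s) (D * s) (D * (2 * t)) doubled) ⟩
      2 * t                                   ∎)
      where
      open ≤-Reasoning
      open +-*-Solver
      far? = λ c → ¬? (b ∼? c)
      B₁ = filter (b ∼?_) B
      B₂ = filter far? B
      s = # (avoids? B₂)
      t = # (avoids? B)
      ih : ∀ {c} → c ∈ B₁ → 2 * D * # (holds? c ∧? avoids? B₂) ≤ s
      ih c∈B₁ with ∈-filter⁻ (b ∼?_) c∈B₁
      ... | c∈B , b∼c = conditional-≤ n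
        -- The neighbour `c` lies in `B` but not in `B₂`, so `B₂` is strictly shorter and the fuel
        -- suffices.
        (≤-trans (filter-notAll far? B (Any.map (λ { refl ¬∼ → ¬∼ b∼c }) c∈B)) |B|≤n)
        (⊆-trans (SublistP.filter-⊆ far? B) B⊆𝓑) (⊆-lookup B⊆𝓑 c∈B)
      recombine : ∀ {ω} → Avoids B₂ ω × Avoids B₁ ω → Avoids B ω
      recombine (av₂ , av₁) = All.tabulate λ {c} c∈ → case b ∼? c of λ where
        (yes b∼c) → All.lookup av₁ (∈-filter⁺ (b ∼?_) c∈ b∼c)
        (no b≁c)  → All.lookup av₂ (∈-filter⁺ far? c∈ b≁c)
      -- At most `D` neighbours, each of conditional probability at most 1/(2D), remove at most half
      -- of the `s` elements. The extra `D * s` on both sides replaces a subtraction.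
      doubled : D * s + D * s ≤ D * (2 * t) + D * s
      doubled = begin
        D * s + D * s                                          ≡⟨ solve 2 (λ d a → d :* a :+ d :* a := con 2 :* d :* a) refl D s ⟩
        2 * D * s                                              ≤⟨ union-bound (2 * D) s (avoids? B₂) B₁ ih ⟩
        2 * D * # (avoids? B₂ ∧? avoids? B₁) + length B₁ * s   ≤⟨ +-mono-≤
                                                                    (*-monoʳ-≤ (2 * D) (#-mono (avoids? B₂ ∧? avoids? B₁) (avoids? B) recombine))
                                                                    (*-monoˡ-≤ s (≤-trans (SublistP.length-mono-≤ (SublistP.filter⁺ (b ∼?_) (b ∼?_) (λ { refl p → p }) B⊆𝓑)) (degree b∈𝓑))) ⟩
        2 * D * t + D * s                                      ≡⟨ cong (_+ D * s) (solve 2 (λ d a → con 2 :* d :* a := d :* (con 2 :* a)) refl D t) ⟩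
        D * (2 * t) + D * s                                    ∎

    -- Events are added one at a time. If no element avoided `b ∷ B`, then `b` would hold wherever
    -- `B` is avoided, so `s ≤ c`; but `c` is at most half of `s`, which forces `s` to vanish.
    avoidable : 0 < length Ω → ∀ {B} → B ⊆ 𝓑 → 0 < # (avoids? B)
    avoidable Ω≢∅ {[]} _ = ≤-trans Ω≢∅ (≤-reflexive (cong length (sym (filter-all (avoids? []) {xs = Ω} (All.tabulate (λ _ → []))))))
    avoidable Ω≢∅ {b ∷ B} B⊆𝓑 = ≰⇒> λ ≤0 → <-irrefl refl (begin-strict
      0                     <⟨ avoidable Ω≢∅ (⊆-trans (b ∷ʳ ⊆-refl) B⊆𝓑) ⟩
      s                     ≤⟨ small (≤-trans (#-split (avoids? B) (holds? b)) (+-monoˡ-≤ c (≤-trans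
                                 (#-mono (avoids? B ∧? ¬? ∘ holds? b) (avoids? (b ∷ B)) (λ (av , ¬b) → ¬b ∷ av)) ≤0))) ⟩
      0                     ∎)
      where
      open ≤-Reasoning
      s = # (avoids? B)
      c = # (holds? b ∧? avoids? B)
      double : c + c ≤ s
      double = begin
        c + c      ≡⟨ cong (c +_) (sym (+-identityʳ c)) ⟩
        2 * c      ≤⟨ *-monoˡ-≤ c (*-monoʳ-≤ 2 (>-nonZero⁻¹ D)) ⟩
        2 * D * c  ≤⟨ conditional-≤ (suc (length B)) ≤-refl (⊆-trans (b ∷ʳ ⊆-refl) B⊆𝓑) (⊆-lookup B⊆𝓑 (here refl)) ⟩
        s          ∎
      small : s ≤ c → s ≤ 0
      small s≤c = ≤-trans s≤c (+-cancelˡ-≤ c c 0 (≤-trans double (≤-trans s≤c (≤-reflexive (sym (+-identityʳ c))))))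

-- Enumerating vectors

vecs : {A : Set} → List A → (q : ℕ) → List (Vec A q)
vecs L zero    = [] ∷ []
vecs L (suc q) = cartesianProductWith _∷_ L (vecs L q)

length-vecs : {A : Set} (L : List A) (q : ℕ) → length (vecs L q) ≡ length L ^ q
length-vecs L zero    = refl
length-vecs L (suc q) = trans (length-cartesianProductWith _∷_ L (vecs L q)) (cong (length L *_) (length-vecs L q))

vecs! : {A : Set} {L : List A} → Unique L → ∀ q → Unique (vecs L q)
vecs! L! zero    = [] ∷ []
vecs! L! (suc q) = Unique.cartesianProductWith⁺ _∷_ (λ { refl → refl , refl }) L! (vecs! L! q)

∈-vecs : {A : Set} {L : List A} {q : ℕ} (v : Vec A q) → (∀ i → lookup v i ∈ L) → v ∈ vecs L q
∈-vecs []      h = here refl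
∈-vecs (a ∷ v) h = ∈-cartesianProductWith⁺ _∷_ (h zero) (∈-vecs v (h ∘ suc))

lookup-extensional : {A : Set} {q : ℕ} {v w : Vec A q} → (∀ i → lookup v i ≡ lookup w i) → v ≡ w
lookup-extensional {v = v} {w} h =
  trans (sym (VecP.tabulate∘lookup v)) (trans (VecP.tabulate-cong h) (VecP.tabulate∘lookup w))

Unique-lookup-injective : {A : Set} {xs : List A} → Unique xs → ∀ i j → List.lookup xs i ≡ List.lookup xs j → i ≡ j
Unique-lookup-injective (_ ∷ xs!)  zero    zero    eq = refl
Unique-lookup-injective (x∉ ∷ xs!) zero    (suc j) eq = contradiction eq (All.lookup x∉ (∈-lookup j))
Unique-lookup-injective (x∉ ∷ xs!) (suc i) zero    eq = contradiction (sym eq) (All.lookup x∉ (∈-lookup i))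
Unique-lookup-injective (_ ∷ xs!)  (suc i) (suc j) eq = cong suc (Unique-lookup-injective xs! i j eq)

length-filter-tabulate : {A : Set} {P : A → Set} (P? : Decidable P) {q : ℕ} (f : Fin q → A) →
  length (filter P? (List.tabulate f)) ≡ Vec.count P? (tabulate f)
length-filter-tabulate P? {zero}  f = refl
length-filter-tabulate P? {suc q} f with does (P? (f zero))
... | true  = cong suc (length-filter-tabulate P? (f ∘ suc))
... | false = length-filter-tabulate P? (f ∘ suc)

length-allFin : ∀ q → length (allFin q) ≡ q
length-allFin q = length-tabulate {n = q} (λ i → i)

-- Subsets as lists and as vectors

elems : {q : ℕ} → Subset q → List (Fin q)
elems []            = []
elems (inside ∷ S)  = zero ∷ map suc (elems S)
elems (outside ∷ S) = map suc (elems S)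

length-elems : {q : ℕ} (S : Subset q) → length (elems S) ≡ ∣ S ∣
length-elems []            = refl
length-elems (inside ∷ S)  = cong suc (trans (length-map suc (elems S)) (length-elems S))
length-elems (outside ∷ S) = trans (length-map suc (elems S)) (length-elems S)

∈-elems⁺ : {q : ℕ} {S : Subset q} {x : Fin q} → x ∈ₛ S → x ∈ elems S
∈-elems⁺ Vec.here = here refl
∈-elems⁺ {S = inside ∷ S}  (Vec.there x∈) = there (∈-map⁺ suc (∈-elems⁺ x∈))
∈-elems⁺ {S = outside ∷ S} (Vec.there x∈) = ∈-map⁺ suc (∈-elems⁺ x∈)

∈-elems⁻ : {q : ℕ} (S : Subset q) {x : Fin q} → x ∈ elems S → x ∈ₛ S
∈-elems⁻ (inside ∷ S)  (here refl) = Vec.here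
∈-elems⁻ (inside ∷ S)  (there x∈) with _ , y∈ , refl ← ∈-map⁻ suc x∈ = Vec.there (∈-elems⁻ S y∈)
∈-elems⁻ (outside ∷ S) x∈         with _ , y∈ , refl ← ∈-map⁻ suc x∈ = Vec.there (∈-elems⁻ S y∈)

elems! : {q : ℕ} (S : Subset q) → Unique (elems S)
elems! []            = []
elems! (inside ∷ S)  = All.tabulate (λ x∈ eq → 0∉ x∈ eq) ∷ Unique.map⁺ FinP.suc-injective (elems! S)
  where
  0∉ : ∀ {x} → x ∈ map suc (elems S) → zero ≢ x
  0∉ x∈ refl with ∈-map⁻ suc x∈
  ... | _ , _ , ()
elems! (outside ∷ S) = Unique.map⁺ FinP.suc-injective (elems! S)

LookupInjective : {A : Set} {q : ℕ} → Vec A q → Set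
LookupInjective v = ∀ i j → lookup v i ≡ lookup v j → i ≡ j

-- Serves twice: it turns a p-set into the vertex vector of an event, and it numbers the vertices of
-- an edge to produce a first valid matrix.
enumerate : {n : ℕ} (U : Subset n) (q : ℕ) → ∣ U ∣ ≡ q → ∃ λ (v : Vec (Fin n) q) →
  LookupInjective v × (∀ i → lookup v i ∈ₛ U) × (∀ {u} → u ∈ₛ U → ∃ λ i → lookup v i ≡ u)
enumerate U q |U|≡q with trans (length-elems U) |U|≡q
... | refl = v
  , (λ i j eq → Unique-lookup-injective (elems! U) i j (trans (sym (v-lookup i)) (trans eq (v-lookup j))))
  , (λ i → subst (_∈ₛ U) (sym (v-lookup i)) (∈-elems⁻ U (∈-lookup i)))
  , (λ u∈U → Any.index (∈-elems⁺ u∈U) , trans (v-lookup _) (sym (lookup-index (∈-elems⁺ u∈U))))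
  where
  v = tabulate (List.lookup (elems U))
  v-lookup = VecP.lookup∘tabulate (List.lookup (elems U))

-- Leads from vertex vectors back to sets, so that the degree hypothesis applies to them.
support : {n q : ℕ} → Vec (Fin n) q → Subset n
support v = tabulate (λ u → does (FinP.any? (λ i → lookup v i FinP.≟ u)))

∈-support⁺ : {n q : ℕ} (v : Vec (Fin n) q) (i : Fin q) → lookup v i ∈ₛ support v
∈-support⁺ v i = VecP.lookup⇒[]= _ _ (trans (VecP.lookup∘tabulate _ (lookup v i))
  (dec-true (FinP.any? (λ j → lookup v j FinP.≟ lookup v i)) (i , refl)))

∈-support⁻ : {n q : ℕ} (v : Vec (Fin n) q) {u : Fin n} → u ∈ₛ support v → ∃ λ i → lookup v i ≡ u
∈-support⁻ v {u} u∈ with FinP.any? (λ i → lookup v i FinP.≟ u) | trans (sym (VecP.lookup∘tabulate _ u)) (VecP.[]=⇒lookup u∈)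
... | yes hit | _ = hit
... | no _    | ()

∣support∣ : {n q : ℕ} (v : Vec (Fin n) q) → LookupInjective v → ∣ support v ∣ ≡ q
∣support∣ {q = q} v v-inj = trans (sym (length-elems (support v))) (≤-antisym
  (≤-trans (Unique⇒length≤ (elems! (support v)) sub₁) (≤-reflexive (length-tabulate (lookup v))))
  (≤-trans (≤-reflexive (sym (length-tabulate (lookup v)))) (Unique⇒length≤ (Unique.tabulate⁺ (v-inj _ _)) sub₂)))
  where
  sub₁ : ∀ {u} → u ∈ elems (support v) → u ∈ List.tabulate (lookup v)
  sub₁ u∈ with ∈-support⁻ v (∈-elems⁻ (support v) u∈)
  ... | i , refl = ∈-tabulate⁺ i
  sub₂ : ∀ {u} → u ∈ List.tabulate (lookup v) → u ∈ elems (support v)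
  sub₂ u∈ with ∈-tabulate⁻ u∈
  ... | i , refl = ∈-elems⁺ (∈-support⁺ v i)

-- Transpositions of vertices

transpose-right : {n : ℕ} (x z : Fin n) → transpose x z z ≡ x
transpose-right x z with z FinP.≟ x
... | yes z≡x = z≡x
... | no _ with z FinP.≟ z
...   | yes _  = refl
...   | no z≢z = contradiction refl z≢z

transpose-other : {n : ℕ} {x z y : Fin n} → y ≢ x → y ≢ z → transpose x z y ≡ y
transpose-other {x = x} {z} {y} y≢x y≢z with y FinP.≟ x
... | yes y≡x = contradiction y≡x y≢x
... | no _ with y FinP.≟ z
...   | yes y≡z = contradiction y≡z y≢z
...   | no _    = refl

transpose-∈ : {n : ℕ} {S : Subset n} {x z : Fin n} → x ∈ₛ S → z ∈ₛ S → ∀ {y} → y ∈ₛ S → transpose x z y ∈ₛ S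
transpose-∈ {x = x} {z} x∈ z∈ {y} y∈ with y FinP.≟ x
... | yes _ = z∈
... | no _ with y FinP.≟ z
...   | yes _ = x∈
...   | no _  = y∈

transpose-injective : {n : ℕ} (x z : Fin n) {y y′ : Fin n} → transpose x z y ≡ transpose x z y′ → y ≡ y′
transpose-injective x z eq = trans (sym (transpose-inverse z x)) (trans (cong (transpose z x) eq) (transpose-inverse z x))

-- The space of tuples of bijections, and swaps within one edge

module Arrangements {r : ℕ} (H : Hypergraph r) where

  Matrix : Set
  Matrix = Vec (Vec (Fin r) (n H)) (m H)

  get : Matrix → Fin (m H) → Fin (n H) → Fin r
  get ω e x = lookup (lookup ω e) x

  -- Injectivity on an `r`-element edge already means bijectivity onto the positions. Entries
  -- outside the edges are free, so every tuple of bijections is counted equally often and the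
  -- distribution stays uniform.
  Valid : Matrix → Set
  Valid ω = ∀ e x y → x ∈ₛ edge H e → y ∈ₛ edge H e → get ω e x ≡ get ω e y → x ≡ y

  valid? : Decidable Valid
  valid? ω = FinP.all? λ e → FinP.all? λ x → FinP.all? λ y →
    (x ∈? edge H e) →-dec (y ∈? edge H e) →-dec (get ω e x FinP.≟ get ω e y) →-dec (x FinP.≟ y)

  Ω : List Matrix
  Ω = filter valid? (vecs (vecs (allFin r) (n H)) (m H))

  Ω! : Unique Ω
  Ω! = Unique.filter⁺ valid? (vecs! (vecs! (Unique.allFin⁺ r) (n H)) (m H))

  ∈-Ω : ∀ {ω} → Valid ω → ω ∈ Ω
  ∈-Ω {ω} = ∈-filter⁺ valid? (∈-vecs ω (λ e → ∈-vecs (lookup ω e) (λ x → ∈-allFin (get ω e x))))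

  Ω⇒Valid : ∀ {ω} → ω ∈ Ω → Valid ω
  Ω⇒Valid = proj₂ ∘ ∈-filter⁻ valid? {xs = vecs (vecs (allFin r) (n H)) (m H)}

  swapColumn : Fin (m H) → Fin (n H) → Fin (n H) → Fin (m H) → Fin (n H) → Fin (n H)
  swapColumn e x z e′ y with e′ FinP.≟ e
  ... | yes _ = transpose x z y
  ... | no _  = y

  swap : Fin (m H) → Fin (n H) → Fin (n H) → Matrix → Matrix
  swap e x z ω = tabulate λ e′ → tabulate λ y → get ω e′ (swapColumn e x z e′ y)

  get-swap : ∀ e x z ω e′ y → get (swap e x z ω) e′ y ≡ get ω e′ (swapColumn e x z e′ y)
  get-swap e x z ω e′ y = trans
    (cong (λ row → lookup row y) (VecP.lookup∘tabulate (λ e′ → tabulate λ y → get ω e′ (swapColumn e x z e′ y)) e′))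
    (VecP.lookup∘tabulate (λ y → get ω e′ (swapColumn e x z e′ y)) y)

  swapColumn-same : ∀ e x z y → swapColumn e x z e y ≡ transpose x z y
  swapColumn-same e x z y with e FinP.≟ e
  ... | yes _  = refl
  ... | no e≢e = contradiction refl e≢e

  get-swap-same : ∀ e x z ω y → get (swap e x z ω) e y ≡ get ω e (transpose x z y)
  get-swap-same e x z ω y = trans (get-swap e x z ω e y) (cong (get ω e) (swapColumn-same e x z y))

  get-swap-fixed : ∀ {e x z} ω {e′ y} → ¬ (e′ ≡ e × (y ≡ x ⊎ y ≡ z)) → get (swap e x z ω) e′ y ≡ get ω e′ y
  get-swap-fixed {e} {x} {z} ω {e′} {y} fixed = trans (get-swap e x z ω e′ y) (cong (get ω e′) column)
    where
    column : swapColumn e x z e′ y ≡ y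
    column with e′ FinP.≟ e
    ... | yes e′≡e = transpose-other (λ y≡x → fixed (e′≡e , inj₁ y≡x)) (λ y≡z → fixed (e′≡e , inj₂ y≡z))
    ... | no _     = refl

  swap-inverse : ∀ e x z ω → swap e z x (swap e x z ω) ≡ ω
  swap-inverse e x z ω = lookup-extensional λ e′ → lookup-extensional λ y →
    trans (get-swap e z x (swap e x z ω) e′ y)
      (trans (get-swap e x z ω e′ (swapColumn e z x e′ y)) (cong (get ω e′) (column e′ y)))
    where
    column : ∀ e′ y → swapColumn e x z e′ (swapColumn e z x e′ y) ≡ y
    column e′ y with e′ FinP.≟ e
    ... | yes _ = transpose-inverse x z
    ... | no _  = refl

  swap-valid : ∀ {e x z ω} → x ∈ₛ edge H e → z ∈ₛ edge H e → Valid ω → Valid (swap e x z ω)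
  swap-valid {e} {x} {z} {ω} x∈ z∈ valid e′ y y′ y∈ y′∈ eq = column-injective y y′ (valid e′ _ _ (column-∈ y∈) (column-∈ y′∈)
      (trans (sym (get-swap e x z ω e′ y)) (trans eq (get-swap e x z ω e′ y′))))
    where
    column-∈ : ∀ {y} → y ∈ₛ edge H e′ → swapColumn e x z e′ y ∈ₛ edge H e′
    column-∈ y∈ with e′ FinP.≟ e
    ... | yes refl = transpose-∈ x∈ z∈ y∈
    ... | no _     = y∈
    column-injective : ∀ y y′ → swapColumn e x z e′ y ≡ swapColumn e x z e′ y′ → y ≡ y′
    column-injective y y′ with e′ FinP.≟ e
    ... | yes _ = transpose-injective x z
    ... | no _  = λ eq → eq

  -- Prescribed entries and the effect of a swap on them

  Cell : Set
  Cell = Fin (m H) × Fin (n H) × Fin r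

  Fills : Matrix → Cell → Set
  Fills ω (e , x , y) = get ω e x ≡ y

  fills? : ∀ ω → Decidable (Fills ω)
  fills? ω (e , x , y) = get ω e x FinP.≟ y

  key : Cell → Fin (m H) × Fin (n H)
  key (e , x , _) = e , x

  vertex : Cell → Fin (n H)
  vertex (_ , x , _) = x

  InEdge : Cell → Set
  InEdge (e , x , _) = x ∈ₛ edge H e

  infix 4 _⋈_ _⋈?_
  _⋈_ : Cell → Cell → Set
  (e , x , y) ⋈ (e′ , x′ , y′) = e ≡ e′ × (x ≡ x′ ⊎ y ≡ y′)

  _⋈?_ : ∀ c d → Dec (c ⋈ d)
  (e , x , y) ⋈? (e′ , x′ , y′) = (e FinP.≟ e′) ×-dec ((x FinP.≟ x′) ⊎-dec (y FinP.≟ y′))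

  -- Only the entries of row `e` at `x` and at `z` change. A cell at `x` shares its vertex with the
  -- first cell; a cell at `z` filled after the swap has position `y`, which has moved there. Both
  -- would be conflicts, so the entry of `d` is untouched.
  swap-reflects-Fills : ∀ {e x y z ω d} → Fills ω (e , x , y) → ¬ (e , x , y) ⋈ d →
    Fills (swap e x z ω) d → Fills ω d
  swap-reflects-Fills {e} {x} {y} {z} {ω} {e′ , x′ , y′} fill c⋈̸d fill′ =
    trans (sym (get-swap-fixed ω fixed)) fill′
    where
    fixed : ¬ (e′ ≡ e × (x′ ≡ x ⊎ x′ ≡ z))
    fixed (refl , inj₁ refl) = c⋈̸d (refl , inj₁ refl)
    fixed (refl , inj₂ refl) = c⋈̸d (refl , inj₂ (trans (sym fill)
      (trans (cong (get ω e) (sym (transpose-right x z))) (trans (sym (get-swap-same e x z ω z)) fill′))))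

  module _ {E : Set} (cells : E → List Cell) where

    Holds : E → Matrix → Set
    Holds b ω = All (Fills ω) (cells b)

    holds? : ∀ b → Decidable (Holds b)
    holds? b ω = all? (fills? ω) (cells b)

    open LocalLemma Ω holds?

    Misses : Cell → E → Set
    Misses c b = All (λ d → ¬ c ⋈ d) (cells b)

    -- The source of lopsidedness: an event that holds after the swap and has no cell in conflict
    -- with the swapped one must have held before.
    swap-preserves-Avoids : ∀ {e x y z ω B} → Fills ω (e , x , y) → All (Misses (e , x , y)) B →
      Avoids B ω → Avoids B (swap e x z ω)
    swap-preserves-Avoids {e} {x} {y} {z} {ω} fill misses avoids = All.zipWith
      (λ (miss , ¬holds) holds → ¬holds (All.zipWith (λ {d} (c⋈̸d , fill′) → swap-reflects-Fills {z = z} {ω} {d} fill c⋈̸d fill′) (miss , holds)))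
      (misses , avoids)

    -- Swap the entry at c with that at a vertex z outside cs. The pair
    -- (original matrix, z) can be recovered, as the entry of c now sits at z.
    fill-step : ∀ (c : Cell) cs {B} → InEdge c → All (λ d → key c ≢ key d) cs → 2 * length cs ≤ r →
      All (Misses c) B →
      r * # ((λ ω → all? (fills? ω) (c ∷ cs)) ∧? avoids? B) ≤ 2 * # ((λ ω → all? (fills? ω) cs) ∧? avoids? B)
    fill-step c@(e , x , y) cs {B} x∈ keys 2|cs|≤r misses = begin
      r * length Φ             ≤⟨ *-monoˡ-≤ (length Φ) enough ⟩
      2 * length Z * length Φ  ≡⟨ trans (*-assoc 2 (length Z) (length Φ)) (cong (2 *_) (*-comm (length Z) (length Φ))) ⟩
      2 * (length Φ * length Z) ≡⟨ cong (2 *_) (sym (trans (length-map swapped (cartesianProduct Φ Z)) (length-cartesianProductWith _,_ Φ Z))) ⟩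
      2 * length (map swapped (cartesianProduct Φ Z)) ≤⟨ *-monoʳ-≤ 2 (Unique⇒length≤
          (Unique-map-on swapped swapped-injective (Unique.cartesianProduct⁺ (Unique.filter⁺ P? Ω!) (Unique.filter⁺ far? (elems! (edge H e)))))
          swapped-∈) ⟩
      2 * # Q? ∎
      where
      open ≤-Reasoning
      P? = (λ ω → all? (fills? ω) (c ∷ cs)) ∧? avoids? B
      Q? = (λ ω → all? (fills? ω) cs) ∧? avoids? B
      Φ = filter P? Ω
      -- All vertices occurring in `cs` are excluded, whichever edge their cells belong to. The
      -- choice `z = x` may remain; the swap is then the identity.
      far? : Decidable (λ z → ¬ z ∈ map vertex cs)
      far? z = ¬? (any? (z FinP.≟_) (map vertex cs))
      Z = filter far? (elems (edge H e))
      swapped : Matrix × Fin (n H) → Matrix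
      swapped (ω , z) = swap e x z ω
      cover : ∀ {z} → z ∈ elems (edge H e) → z ∈ Z ++ map vertex cs
      cover {z} z∈ with any? (z FinP.≟_) (map vertex cs)
      ... | yes near = ∈-++⁺ʳ Z near
      ... | no far   = ∈-++⁺ˡ (∈-filter⁺ far? z∈ far)
      r≤ : r ≤ length Z + length cs
      r≤ = begin
        r                                 ≡⟨ sym (trans (length-elems (edge H e)) (uniform H e)) ⟩
        length (elems (edge H e))         ≤⟨ Unique⇒length≤ (elems! (edge H e)) cover ⟩
        length (Z ++ map vertex cs)       ≡⟨ trans (length-++ Z) (cong (length Z +_) (length-map vertex cs)) ⟩
        length Z + length cs              ∎
      -- At most `length cs`, hence at most half, of the `r` vertices of the edge are excluded. This
      -- is the origin of the factor 2.
      enough : r ≤ 2 * length Z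
      enough = +-cancelʳ-≤ r r (2 * length Z) (begin
        r + r                             ≡⟨ cong (r +_) (sym (+-identityʳ r)) ⟩
        2 * r                             ≤⟨ *-monoʳ-≤ 2 r≤ ⟩
        2 * (length Z + length cs)        ≡⟨ *-distribˡ-+ 2 (length Z) (length cs) ⟩
        2 * length Z + 2 * length cs      ≤⟨ +-monoʳ-≤ (2 * length Z) 2|cs|≤r ⟩
        2 * length Z + r                  ∎)
      in-Z : ∀ {z} → z ∈ Z → z ∈ₛ edge H e × ¬ z ∈ map vertex cs
      in-Z z∈ with ∈-filter⁻ far? z∈
      ... | z∈e , far = ∈-elems⁻ (edge H e) z∈e , far
      entry-z : ∀ {ω z} → ω ∈ Φ → get (swap e x z ω) e z ≡ y
      entry-z {ω} {z} ω∈ with ∈-filter⁻ P? {xs = Ω} ω∈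
      ... | _ , (fill ∷ _) , _ = trans (get-swap-same e x z ω z) (trans (cong (get ω e) (transpose-right x z)) fill)
      swapped-injective : ∀ {u v} → u ∈ cartesianProduct Φ Z → v ∈ cartesianProduct Φ Z → swapped u ≡ swapped v → u ≡ v
      swapped-injective {ω , z} {ω′ , z′} u∈ v∈ eq
        with ω∈ , z∈ ← ∈-cartesianProduct⁻ Φ Z u∈
           | ω′∈ , z′∈ ← ∈-cartesianProduct⁻ Φ Z v∈
        -- The common swapped matrix has position `y` in row `e` both at `z` and at `z′`, and that
        -- row is injective on the edge.
        with swap-valid {ω = ω} x∈ (proj₁ (in-Z z∈)) (Ω⇒Valid {ω} (proj₁ (∈-filter⁻ P? {xs = Ω} ω∈))) e z z′ (proj₁ (in-Z z∈)) (proj₁ (in-Z z′∈))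
               (trans (entry-z {ω} {z} ω∈) (sym (trans (cong (λ τ → get τ e z′) eq) (entry-z {ω′} {z′} ω′∈))))
      ... | refl = cong (_, z) (trans (sym (swap-inverse e x z ω)) (trans (cong (swap e z x) eq) (swap-inverse e x z ω′)))
      still-fills : ∀ {ω z} → ¬ z ∈ map vertex cs → All (Fills ω) cs → All (Fills (swap e x z ω)) cs
      -- A cell of `cs` at `x` in edge `e` would have the key of `c`, and the choice of `z` rules
      -- out a cell at `z`.
      still-fills {ω} {z} far fills = All.tabulate λ {d} d∈ → trans
        (get-swap-fixed ω λ where
          (refl , inj₁ refl) → All.lookup keys d∈ refl
          (refl , inj₂ refl) → far (∈-map⁺ vertex d∈))
        (All.lookup fills d∈)
      swapped-∈ : ∀ {τ} → τ ∈ map swapped (cartesianProduct Φ Z) → τ ∈ filter Q? Ω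
      swapped-∈ τ∈ with ∈-map⁻ swapped τ∈
      ... | (ω , z) , u∈ , refl with ∈-cartesianProduct⁻ Φ Z u∈
      ... | ω∈ , z∈ with ∈-filter⁻ P? {xs = Ω} ω∈ | in-Z z∈
      ... | ω∈Ω , (fill ∷ fills) , avoids | z∈e , far =
        ∈-filter⁺ Q? (∈-Ω {swap e x z ω} (swap-valid {ω = ω} x∈ z∈e (Ω⇒Valid {ω} ω∈Ω))) (still-fills {ω} far fills , swap-preserves-Avoids {ω = ω} fill misses avoids)

    -- Dropping the cells one after another costs a factor 2/r each, so the conditional probability
    -- of filling all of them is at most (2/r) to the power `length cs`.
    fill-all : ∀ cs {B} → AllPairs (λ c d → key c ≢ key d) cs → All InEdge cs → 2 * length cs ≤ r →
      All (λ c → All (Misses c) B) cs →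
      r ^ length cs * # ((λ ω → all? (fills? ω) cs) ∧? avoids? B) ≤ 2 ^ length cs * # (avoids? B)
    fill-all [] {B} _ _ _ _ = *-monoʳ-≤ 1 (#-mono ((λ ω → all? (fills? ω) []) ∧? avoids? B) (avoids? B) proj₂)
    fill-all (c ∷ cs) {B} (keys ∷ distinct) (c∈ ∷ cs∈) 2|cs|≤r (miss ∷ misses) = begin
      r * r ^ l * a       ≡⟨ solve 3 (λ r x a → r :* x :* a := x :* (r :* a)) refl r (r ^ l) a ⟩
      r ^ l * (r * a)     ≤⟨ *-monoʳ-≤ (r ^ l) (fill-step c cs c∈ keys 2l≤r miss) ⟩
      r ^ l * (2 * b)     ≡⟨ solve 2 (λ x b → x :* (con 2 :* b) := con 2 :* (x :* b)) refl (r ^ l) b ⟩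
      2 * (r ^ l * b)     ≤⟨ *-monoʳ-≤ 2 (fill-all cs distinct cs∈ 2l≤r misses) ⟩
      2 * (2 ^ l * s)     ≡⟨ sym (*-assoc 2 (2 ^ l) s) ⟩
      2 * 2 ^ l * s       ∎
      where
      open ≤-Reasoning
      open +-*-Solver
      l = length cs
      a = # ((λ ω → all? (fills? ω) (c ∷ cs)) ∧? avoids? B)
      b = # ((λ ω → all? (fills? ω) cs) ∧? avoids? B)
      s = # (avoids? B)
      2l≤r = ≤-trans (*-monoʳ-≤ 2 (n≤1+n l)) 2|cs|≤r

-- Images of sets, and vectors with one prescribed entry

∈-concatMap : {A B : Set} (f : A → List B) {xs : List A} {x : A} {y : B} → x ∈ xs → y ∈ f x → y ∈ concatMap f xs
∈-concatMap f x∈ y∈ = ∈-concatMap⁺ f (lose x∈ y∈)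

Unique-subsingleton : {A : Set} {xs : List A} → Unique xs → (∀ {x y} → x ∈ xs → y ∈ xs → x ≡ y) → length xs ≤ 1
Unique-subsingleton {xs = []}        _ _ = z≤n
Unique-subsingleton {xs = x ∷ []}    _ _ = s≤s z≤n
Unique-subsingleton {xs = x ∷ y ∷ _} ((x≢y ∷ _) ∷ _) h = contradiction (h (here refl) (there (here refl))) x≢y

anyFin⁺ : {q : ℕ} (f : Fin q → Bool) (i : Fin q) → f i ≡ true → anyFin f ≡ true
anyFin⁺ f zero    eq rewrite eq = refl
anyFin⁺ f (suc i) eq with f zero
... | true  = refl
... | false = anyFin⁺ (f ∘ suc) i eq

anyFin⁻ : {q : ℕ} (f : Fin q → Bool) → anyFin f ≡ true → ∃ λ i → f i ≡ true
anyFin⁻ {suc q} f eq with f zero in f0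
... | true = zero , f0
... | false with anyFin⁻ (f ∘ suc) eq
...   | i , fi = suc i , fi

∈-image⁺ : {n r : ℕ} (σ : Fin n → Fin r) {U : Subset n} {u : Fin n} → u ∈ₛ U → σ u ∈ₛ image σ U
∈-image⁺ σ {U} {u} u∈ = VecP.lookup⇒[]= _ _ (trans (VecP.lookup∘tabulate _ (σ u)) (anyFin⁺ _ u hit))
  where
  hit : lookup U u ∧ does (σ u FinP.≟ σ u) ≡ true
  hit rewrite VecP.[]=⇒lookup u∈ | dec-true (σ u FinP.≟ σ u) refl = refl

∈-image⁻ : {n r : ℕ} (σ : Fin n → Fin r) {U : Subset n} {j : Fin r} → j ∈ₛ image σ U → ∃ λ u → u ∈ₛ U × σ u ≡ j
∈-image⁻ σ {U} {j} j∈ with anyFin⁻ (λ u → lookup U u ∧ does (σ u FinP.≟ j)) (trans (sym (VecP.lookup∘tabulate _ j)) (VecP.[]=⇒lookup j∈))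
... | u , hit with lookup U u in Uu | σ u FinP.≟ j
...   | true | yes σu≡j = u , VecP.lookup⇒[]= u U Uu , σu≡j

lookup-removeAt : {A : Set} {s : ℕ} (v : Vec A (suc s)) (j : Fin (suc s)) (i : Fin s) →
  lookup (removeAt v j) i ≡ lookup v (punchIn j i)
lookup-removeAt (_ ∷ _)         zero    i       = refl
lookup-removeAt (_ ∷ _ ∷ _)     (suc j) zero    = refl
lookup-removeAt (_ ∷ v@(_ ∷ _)) (suc j) (suc i) = lookup-removeAt v j i

-- With entry `j` prescribed only `s` entries are free. This saves the factor `r` on which the count
-- of conflicting events depends.
∈-map-insertAt : {A : Set} {L : List A} {s : ℕ} (v : Vec A (suc s)) (j : Fin (suc s)) → (∀ i → lookup v i ∈ L) →
  v ∈ map (λ t → insertAt t j (lookup v j)) (vecs L s)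
∈-map-insertAt {L = L} {s} v j h = subst (_∈ map (λ t → insertAt t j (lookup v j)) (vecs L s)) (VecP.insertAt-removeAt v j)
  (∈-map⁺ (λ t → insertAt t j (lookup v j))
    (∈-vecs (removeAt v j) (λ i → subst (_∈ L) (sym (lookup-removeAt v j i)) (h (punchIn j i)))))

-- Events of equal images in two edges

module Conflicts {r : ℕ} (H : Hypergraph r) (q k : ℕ) (maxdeg : MaxDegLe H (suc q) k) where
  open Arrangements H

  p : ℕ
  p = suc q

  -- (e , f , x , a , π) is the event that the vertices xᵢ have positions aᵢ in e
  -- and a_{π i} in f, so that x has the same image in both edges.
  Event : Set
  Event = Fin (m H) × Fin (m H) × Vec (Fin (n H)) p × Vec (Fin r) p × Vec (Fin p) p

  cells : Event → List Cell
  cells (e , f , x , a , π) =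
    map (λ i → e , lookup x i , lookup a i) (allFin p) ++
    map (λ i → f , lookup x i , lookup a (lookup π i)) (allFin p)

  length-cells : ∀ b → length (cells b) ≡ p + p
  length-cells (e , f , x , a , π) = trans (length-++ (map (λ i → e , lookup x i , lookup a i) (allFin p)))
    (cong₂ _+_ (trans (length-map _ (allFin p)) (length-allFin p)) (trans (length-map _ (allFin p)) (length-allFin p)))

  -- The two indices are kept apart because in the second edge the position belonging to vertex `i`
  -- has index `π i`; the count of neighbours can then ignore `π`.
  ∈-cells : ∀ {e f x a π d} → d ∈ cells (e , f , x , a , π) → ∃ λ i → ∃ λ j →
    (d ≡ (e , lookup x i , lookup a j)) ⊎ (d ≡ (f , lookup x i , lookup a j))
  ∈-cells {e} {f} {x} {a} {π} d∈ with ∈-++⁻ (map (λ i → e , lookup x i , lookup a i) (allFin p)) d∈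
  ... | inj₁ d∈₁ with i , _ , refl ← ∈-map⁻ _ d∈₁ = i , i , inj₁ refl
  ... | inj₂ d∈₂ with i , _ , refl ← ∈-map⁻ _ d∈₂ = i , lookup π i , inj₂ refl

  Contains : Vec (Fin (n H)) p → Fin (m H) → Set
  Contains x e = ∀ i → lookup x i ∈ₛ edge H e

  contains? : ∀ x → Decidable (Contains x)
  contains? x e = FinP.all? λ i → lookup x i ∈? edge H e

  -- Distinct edges and distinct vertices give the cells distinct keys and make the codegree bound
  -- applicable; containment in both edges allows the swaps.
  Proper : Event → Set
  Proper (e , f , x , _ , _) = e ≢ f × LookupInjective x × Contains x e × Contains x f

  proper? : Decidable Proper
  proper? (e , f , x , _ , _) = ¬? (e FinP.≟ f)
    ×-dec (FinP.all? λ i → FinP.all? λ j → (lookup x i FinP.≟ lookup x j) →-dec (i FinP.≟ j))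
    ×-dec contains? x e ×-dec contains? x f

  -- Here `π` runs through all self-maps of the index set, giving simply `p ^ p` choices.
  𝓑 : List Event
  𝓑 = filter proper? (cartesianProduct (allFin (m H)) (cartesianProduct (allFin (m H))
    (cartesianProduct (vecs (allFin (n H)) p) (cartesianProduct (vecs (allFin r) p) (vecs (allFin p) p)))))

  𝓑! : Unique 𝓑
  𝓑! = Unique.filter⁺ proper? (Unique.cartesianProduct⁺ (Unique.allFin⁺ _) (Unique.cartesianProduct⁺ (Unique.allFin⁺ _)
    (Unique.cartesianProduct⁺ (vecs! (Unique.allFin⁺ _) p) (Unique.cartesianProduct⁺ (vecs! (Unique.allFin⁺ r) p) (vecs! (Unique.allFin⁺ p) p)))))

  ∈-full : ∀ {s t} (v : Vec (Fin s) t) → v ∈ vecs (allFin s) t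
  ∈-full v = ∈-vecs v (λ i → ∈-allFin (lookup v i))

  ∈-𝓑 : ∀ {b} → Proper b → b ∈ 𝓑
  ∈-𝓑 {e , f , x , a , π} = ∈-filter⁺ proper? (∈-cartesianProduct⁺ (∈-allFin e) (∈-cartesianProduct⁺ (∈-allFin f)
    (∈-cartesianProduct⁺ (∈-full x) (∈-cartesianProduct⁺ (∈-full a) (∈-full π)))))

  𝓑⇒Proper : ∀ {b} → b ∈ 𝓑 → Proper b
  𝓑⇒Proper b∈ = proj₂ (∈-filter⁻ proper? {xs = cartesianProduct (allFin (m H)) (cartesianProduct (allFin (m H))
    (cartesianProduct (vecs (allFin (n H)) p) (cartesianProduct (vecs (allFin r) p) (vecs (allFin p) p))))} b∈)

  infix 4 _∼_ _∼?_
  _∼_ : Event → Event → Set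
  b ∼ c = Any (λ d → Any (d ⋈_) (cells c)) (cells b)

  _∼?_ : ∀ b c → Dec (b ∼ c)
  b ∼? c = any? (λ d → any? (d ⋈?_) (cells c)) (cells b)

  codegree-≤ : ∀ x → LookupInjective x → length (filter (contains? x) (allFin (m H))) ≤ k
  codegree-≤ x x-inj = begin
    length (filter (contains? x) (allFin (m H)))                  ≤⟨ Unique⇒length≤ (Unique.filter⁺ (contains? x) (Unique.allFin⁺ _))
                                                                       (λ e∈ → case ∈-filter⁻ (contains? x) {xs = allFin (m H)} e∈ of λ (e∈′ , x⊆e) →
                                                                         ∈-filter⁺ (λ e → support x ⊆? edge H e) e∈′ (support-⊆ x⊆e)) ⟩
    length (filter (λ e → support x ⊆? edge H e) (allFin (m H)))  ≡⟨ length-filter-tabulate (λ e → support x ⊆? edge H e) (λ e → e) ⟩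
    codeg H (support x)                                           ≤⟨ maxdeg (support x) (∣support∣ x x-inj) ⟩
    k                                                             ∎
    where
    open ≤-Reasoning
    support-⊆ : ∀ {e} → Contains x e → support x ⊆ₛ edge H e
    support-⊆ x⊆e u∈ with ∈-support⁻ x u∈
    ... | i , refl = x⊆e i

  -- Truncating to k loses nothing when x has distinct entries, by codegree-≤.
  common : Vec (Fin (n H)) p → List (Fin (m H))
  common x = take k (filter (contains? x) (allFin (m H)))

  ∈-common : ∀ {x h} → LookupInjective x → Contains x h → h ∈ common x
  ∈-common {x} {h} x-inj x⊆h = subst (h ∈_) (sym (take-all k _ (codegree-≤ x x-inj))) (∈-filter⁺ (contains? x) (∈-allFin h) x⊆h)

  -- This is where the degree bound enters: once one edge `g` and the vertices `x` are known, the
  -- other edge is among at most `k` edges containing `x`. The two listed events are the two orders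
  -- of the edges.
  completions : Fin (m H) → List (Vec (Fin r) p) → Vec (Fin (n H)) p → List Event
  completions g as x = concatMap (λ h → concatMap (λ a → concatMap (λ π →
    (g , h , x , a , π) ∷ (h , g , x , a , π) ∷ []) (vecs (allFin p) p)) as) (common x)

  length-completions : ∀ g as x → length (completions g as x) ≤ k * (length as * (p ^ p * 2))
  length-completions g as x = ≤-trans
    (length-concatMap-≤ _ (common x) λ h → length-concatMap-≤ _ as λ a →
      ≤-trans (length-concatMap-≤ _ (vecs (allFin p) p) λ π → ≤-refl)
        (≤-reflexive (cong (_* 2) (trans (length-vecs (allFin p) p) (cong (_^ p) (length-allFin p))))))
    (*-monoˡ-≤ (length as * (p ^ p * 2)) (≤-trans (≤-reflexive (length-take k _)) (m⊓n≤m k _)))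

  -- Of the `p` vertices and `p` positions of a neighbour one vertex is fixed here, and one position
  -- in `sharingPosition`. Since the other vertices lie in `g`, each leaves `r ^ (q + p)` choices of
  -- `x` and `a`, one power of `r` less than without a conflict.
  sharingVertex : Fin (m H) → Fin p → Fin (n H) → List Event
  sharingVertex g j v = concatMap (completions g (vecs (allFin r) p))
    (map (λ t → insertAt t j v) (vecs (elems (edge H g)) q))

  sharingPosition : Fin (m H) → Fin p → Fin r → List Event
  sharingPosition g j y = concatMap (completions g (map (λ t → insertAt t j y) (vecs (allFin r) q)))
    (vecs (elems (edge H g)) p)

  sharing : Vec (Fin (n H)) p → Vec (Fin r) p → Fin (m H) → Fin p → Fin p → List Event
  sharing x a g i j = sharingVertex g j (lookup x i) ++ sharingPosition g j (lookup a i)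

  sharingEdge : Vec (Fin (n H)) p → Vec (Fin r) p → Fin (m H) → List Event
  sharingEdge x a g = concatMap (λ i → concatMap (sharing x a g i) (allFin p)) (allFin p)

  neighbours : Event → List Event
  neighbours (e , f , x , a , _) = concatMap (sharingEdge x a) (e ∷ f ∷ [])

  -- 8 counts the choices of the common edge within b, of its place within the
  -- neighbour, and between a common vertex and a common position.
  C D : ℕ
  C = 8 * p * p * k * p ^ p
  D = C * r ^ (q + p)

  -- The number of conflicting events

  length-vecs-edge : ∀ g s → length (vecs (elems (edge H g)) s) ≡ r ^ s
  length-vecs-edge g s = trans (length-vecs (elems (edge H g)) s) (cong (_^ s) (trans (length-elems (edge H g)) (uniform H g)))

  length-vecs-positions : ∀ s → length (vecs (allFin r) s) ≡ r ^ s
  length-vecs-positions s = trans (length-vecs (allFin r) s) (cong (_^ s) (length-allFin r))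

  length-sharingVertex : ∀ g j v → length (sharingVertex g j v) ≤ r ^ q * (k * (r ^ p * (p ^ p * 2)))
  length-sharingVertex g j v = ≤-trans
    (length-concatMap-≤ _ (map (λ t → insertAt t j v) (vecs (elems (edge H g)) q)) (length-completions g (vecs (allFin r) p)))
    (≤-reflexive (cong₂ (λ s t → s * (k * (t * (p ^ p * 2))))
      (trans (length-map _ (vecs (elems (edge H g)) q)) (length-vecs-edge g q)) (length-vecs-positions p)))

  length-sharingPosition : ∀ g j y → length (sharingPosition g j y) ≤ r ^ p * (k * (r ^ q * (p ^ p * 2)))
  length-sharingPosition g j y = ≤-trans
    (length-concatMap-≤ _ (vecs (elems (edge H g)) p) (length-completions g (map (λ t → insertAt t j y) (vecs (allFin r) q))))
    (≤-reflexive (cong₂ (λ s t → s * (k * (t * (p ^ p * 2))))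
      (length-vecs-edge g p) (trans (length-map _ (vecs (allFin r) q)) (length-vecs-positions q))))

  length-neighbours : ∀ b → length (neighbours b) ≤ D
  length-neighbours (e , f , x , a , π) = begin
    length (neighbours (e , f , x , a , π)) ≤⟨ (length-concatMap-≤ (sharingEdge x a) (e ∷ f ∷ []) λ g →
        over-indices (λ i → concatMap (sharing x a g i) (allFin p)) λ i → over-indices (sharing x a g i) λ j →
          ≤-trans (≤-reflexive (length-++ (sharingVertex g j (lookup x i)) {sharingPosition g j (lookup a i)}))
            (+-mono-≤ (length-sharingVertex g j (lookup x i)) (length-sharingPosition g j (lookup a i)))) ⟩
    2 * (p * (p * (r ^ q * (k * (r ^ p * (p ^ p * 2))) + r ^ p * (k * (r ^ q * (p ^ p * 2))))))
      ≡⟨ solve 5 (λ p k P Q R → con 2 :* (p :* (p :* (Q :* (k :* (R :* (P :* con 2))) :+ R :* (k :* (Q :* (P :* con 2))))))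
                   := con 8 :* p :* p :* k :* P :* (Q :* R)) refl p k (p ^ p) (r ^ q) (r ^ p) ⟩
    C * (r ^ q * r ^ p)  ≡⟨ cong (C *_) (sym (^-distribˡ-+-* r q p)) ⟩
    D                    ∎
    where
    open ≤-Reasoning
    open +-*-Solver
    over-indices : (f : Fin p → List Event) {c : ℕ} → (∀ i → length (f i) ≤ c) → length (concatMap f (allFin p)) ≤ p * c
    over-indices f {c} h = ≤-trans (length-concatMap-≤ f (allFin p) h) (≤-reflexive (cong (_* c) (length-allFin p)))

  -- Records in which of the two slots `g` stands, and that the other edge contains `x`, so that
  -- both orders are treated alike.
  data Joins (g : Fin (m H)) (x : Vec (Fin (n H)) p) (a : Vec (Fin r) p) : Event → Set where
    first  : ∀ {h π} → Contains x h → Joins g x a (g , h , x , a , π)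
    second : ∀ {h π} → Contains x h → Joins g x a (h , g , x , a , π)

  ∈-completions : ∀ {g as x a c} → LookupInjective x → a ∈ as → Joins g x a c → c ∈ completions g as x
  ∈-completions {g} {as} {x} x-inj a∈ (first {π = π} x⊆h) =
    ∈-concatMap _ (∈-common {x} x-inj x⊆h) (∈-concatMap _ a∈ (∈-concatMap _ (∈-full π) (here refl)))
  ∈-completions {g} {as} {x} x-inj a∈ (second {π = π} x⊆h) =
    ∈-concatMap _ (∈-common {x} x-inj x⊆h) (∈-concatMap _ a∈ (∈-concatMap _ (∈-full π) (there (here refl))))

  ∈-sharing : ∀ {g x a c v y} j → LookupInjective x → Contains x g → Joins g x a c →
    v ≡ lookup x j ⊎ y ≡ lookup a j → c ∈ sharingVertex g j v ++ sharingPosition g j y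
  ∈-sharing {g} {x} {a} j x-inj x⊆g joins (inj₁ refl) = ∈-++⁺ˡ
    (∈-concatMap _ (∈-map-insertAt x j (λ i → ∈-elems⁺ (x⊆g i))) (∈-completions x-inj (∈-full a) joins))
  ∈-sharing {g} {x} {a} {v = v} j x-inj x⊆g joins (inj₂ refl) = ∈-++⁺ʳ (sharingVertex g j v)
    (∈-concatMap _ (∈-vecs x (λ i → ∈-elems⁺ (x⊆g i)))
      (∈-completions x-inj (∈-map-insertAt a j (λ i → ∈-allFin (lookup a i))) joins))

  -- A conflict supplies one cell of each event in a common edge. Finding which slot that edge
  -- occupies on either side, and whether the vertex or the position agrees, locates `c` in the
  -- list.
  ∼⇒∈-neighbours : ∀ {b c} → Proper c → b ∼ c → c ∈ neighbours b
  ∼⇒∈-neighbours {e , f , x , a , π} {c@(e′ , f′ , x′ , a′ , π′)} (_ , x′-inj , x′⊆e′ , x′⊆f′) b∼c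
    with d , d∈ , hit ← find b∼c
    with d′ , d′∈ , same , shared ← find hit
    with ∈-cells {e} {f} {x} {a} {π} d∈ | ∈-cells {e′} {f′} {x′} {a′} {π′} d′∈
  ... | i , j , d≡ | i′ , j′ , d′≡ = link d≡ d′≡ same shared
    where
    at : ∀ g → g ∈ e ∷ f ∷ [] → Joins g x′ a′ c → Contains x′ g →
      lookup x i ≡ lookup x′ i′ ⊎ lookup a j ≡ lookup a′ j′ → c ∈ neighbours (e , f , x , a , π)
    at g g∈ joins x′⊆g (inj₁ eq) = ∈-concatMap (sharingEdge x a) g∈ (∈-concatMap (λ i → concatMap (sharing x a g i) (allFin p)) (∈-allFin i)
      (∈-concatMap (sharing x a g i) (∈-allFin i′) (∈-sharing i′ x′-inj x′⊆g joins (inj₁ eq))))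
    -- A shared position is indexed by `j` and `j′`, which differ from the vertex indices when the
    -- cell comes from a second edge.
    at g g∈ joins x′⊆g (inj₂ eq) = ∈-concatMap (sharingEdge x a) g∈ (∈-concatMap (λ i → concatMap (sharing x a g i) (allFin p)) (∈-allFin j)
      (∈-concatMap (sharing x a g j) (∈-allFin j′) (∈-sharing j′ x′-inj x′⊆g joins (inj₂ eq))))
    link : ∀ {g v y g′ v′ y′} →
      (g , v , y) ≡ (e , lookup x i , lookup a j) ⊎ (g , v , y) ≡ (f , lookup x i , lookup a j) →
      (g′ , v′ , y′) ≡ (e′ , lookup x′ i′ , lookup a′ j′) ⊎ (g′ , v′ , y′) ≡ (f′ , lookup x′ i′ , lookup a′ j′) →
      g ≡ g′ → v ≡ v′ ⊎ y ≡ y′ → c ∈ neighbours (e , f , x , a , π)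
    link (inj₁ refl) (inj₁ refl) refl = at e′ (here refl) (first x′⊆f′) x′⊆e′
    link (inj₁ refl) (inj₂ refl) refl = at f′ (here refl) (second x′⊆e′) x′⊆f′
    link (inj₂ refl) (inj₁ refl) refl = at e′ (there (here refl)) (first x′⊆f′) x′⊆e′
    link (inj₂ refl) (inj₂ refl) refl = at f′ (there (here refl)) (second x′⊆e′) x′⊆f′

  degree-≤ : ∀ {b} → b ∈ 𝓑 → length (filter (b ∼?_) 𝓑) ≤ D
  degree-≤ {b} _ = ≤-trans (Unique⇒length≤ (Unique.filter⁺ (b ∼?_) 𝓑!) sub) (length-neighbours b)
    where
    sub : ∀ {c} → c ∈ filter (b ∼?_) 𝓑 → c ∈ neighbours b
    sub {c} c∈ with ∈-filter⁻ (b ∼?_) {xs = 𝓑} c∈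
    ... | c∈𝓑 , b∼c = ∼⇒∈-neighbours {b} {c} (𝓑⇒Proper {c} c∈𝓑) b∼c

  -- Within one edge the vertices differ by injectivity of `x`; between the two halves the edges
  -- differ.
  cells-distinct : ∀ {b} → Proper b → AllPairs (λ c d → key c ≢ key d) (cells b)
  cells-distinct {e , f , x , a , π} (e≢f , x-inj , _ , _) = AllPairsP.++⁺
    (row e (lookup a)) (row f (λ i → lookup a (lookup π i)))
    (All.tabulate λ c∈ → All.tabulate λ d∈ eq → cross (∈-map⁻ _ c∈) (∈-map⁻ _ d∈) eq)
    where
    row : ∀ g (y : Fin p → Fin r) → AllPairs (λ c d → key c ≢ key d) (map (λ i → g , lookup x i , y i) (allFin p))
    row g y = AllPairsP.map⁺ (AllPairs.map (λ i≢j eq → i≢j (x-inj _ _ (cong proj₂ eq))) (Unique.allFin⁺ p))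
    cross : ∀ {c d} {y y′ : Fin p → Fin r} →
      (∃ λ i → i ∈ allFin p × c ≡ (e , lookup x i , y i)) → (∃ λ i → i ∈ allFin p × d ≡ (f , lookup x i , y′ i)) →
      key c ≢ key d
    cross (_ , _ , refl) (_ , _ , refl) eq = e≢f (cong proj₁ eq)

  cells-InEdge : ∀ {b} → Proper b → All InEdge (cells b)
  cells-InEdge {e , f , x , a , π} (_ , _ , x⊆e , x⊆f) = All.tabulate λ {d} d∈ → go {d} (∈-cells {e} {f} {x} {a} {π} d∈)
    where
    go : ∀ {d} → (∃ λ i → ∃ λ j → (d ≡ (e , lookup x i , lookup a j)) ⊎ (d ≡ (f , lookup x i , lookup a j))) → InEdge d
    go (i , _ , inj₁ refl) = x⊆e i
    go (i , _ , inj₂ refl) = x⊆f i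

  -- Applying the local lemma for large `r`

  open LocalLemma Ω (holds? cells)

  -- The first summand brings the event probability below 1/(4D); the second leaves at least half of
  -- an edge free for the swaps when `2p` cells are filled.
  module _ (large : 4 * C * 2 ^ (p + p) + 4 * p ≤ r) where

    -- By `fill-all` the conditional probability is at most (2/r) to the power `2p`. As `D` is `C`
    -- times the power `2p - 1` of `r`, one factor `r` is left to absorb `4 * C * 2 ^ (p + p)`.
    lopsided : ∀ {b B} → b ∈ 𝓑 → All (λ c → ¬ b ∼ c) B →
      4 * D * # (holds? cells b ∧? avoids? B) ≤ # (avoids? B)
    lopsided {b} {B} b∈ far = *-cancelˡ-≤ (2 ^ (p + p)) {{m^n≢0 2 (p + p)}} (begin
      2 ^ (p + p) * (4 * (C * r ^ (q + p)) * N)  ≡⟨ solve 4 (λ t c R a → t :* (con 4 :* (c :* R) :* a) := con 4 :* c :* t :* R :* a)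
                                                     refl (2 ^ (p + p)) C (r ^ (q + p)) N ⟩
      4 * C * 2 ^ (p + p) * r ^ (q + p) * N      ≤⟨ *-monoˡ-≤ N (*-monoˡ-≤ (r ^ (q + p)) (≤-trans (m≤m+n (4 * C * 2 ^ (p + p)) (4 * p)) large)) ⟩
      r ^ (p + p) * N                            ≤⟨ subst (λ l → r ^ l * N ≤ 2 ^ l * # (avoids? B)) (length-cells b)
                                                     (fill-all cells (cells b) (cells-distinct {b} proper) (cells-InEdge {b} proper) short misses) ⟩
      2 ^ (p + p) * # (avoids? B)                ∎)
      where
      open ≤-Reasoning
      open +-*-Solver
      N = # (holds? cells b ∧? avoids? B)
      proper = 𝓑⇒Proper {b} b∈
      short : 2 * length (cells b) ≤ r
      short = begin
        2 * length (cells b)          ≡⟨ cong (2 *_) (length-cells b) ⟩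
        2 * (p + p)                   ≡⟨ solve 1 (λ p → con 2 :* (p :+ p) := con 4 :* p) refl p ⟩
        4 * p                         ≤⟨ m≤n+m (4 * p) (4 * C * 2 ^ (p + p)) ⟩
        4 * C * 2 ^ (p + p) + 4 * p   ≤⟨ large ⟩
        r                             ∎
      misses : All (λ c → All (Misses cells c) B) (cells b)
      misses = All.tabulate λ c∈ → All.map (λ b≁c → All.tabulate λ d∈ c⋈d → b≁c (lose c∈ (lose d∈ c⋈d))) far

    instance
      r≢0 : NonZero r
      r≢0 = >-nonZero (≤-trans (s≤s z≤n) (≤-trans (m≤n+m (4 * p) (4 * C * 2 ^ (p + p))) large))

    -- Shows that `Ω` is non-empty, the starting point of the local lemma.
    rankMatrix : Matrix
    rankMatrix = tabulate λ e → tabulate λ x → rank e x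
      module Rank where
      rank : Fin (m H) → Fin (n H) → Fin r
      rank e x with x ∈? edge H e
      ... | yes x∈ = proj₁ (proj₂ (proj₂ (proj₂ (enumerate (edge H e) r (uniform H e)))) x∈)
      -- An arbitrary default, position zero: `Valid` constrains only vertices of the edge.
      ... | no _   = fromℕ< (>-nonZero⁻¹ r)

    rankMatrix-valid : Valid rankMatrix
    rankMatrix-valid e x y x∈ y∈ eq = rank-injective (trans (sym (get-rank x)) (trans eq (get-rank y)))
      where
      open Rank
      get-rank : ∀ x → get rankMatrix e x ≡ rank e x
      get-rank x = trans (cong (λ row → lookup row x) (VecP.lookup∘tabulate (λ e → tabulate (rank e)) e))
        (VecP.lookup∘tabulate (rank e) x)
      rank-injective : rank e x ≡ rank e y → x ≡ y
      rank-injective eq with x ∈? edge H e | y ∈? edge H e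
      ... | no x∉   | _       = contradiction x∈ x∉
      ... | yes _   | no y∉   = contradiction y∈ y∉
      ... | yes x∈′ | yes y∈′ = trans (sym (proj₂ (position x∈′)))
          (trans (cong (lookup (proj₁ (enumerate (edge H e) r (uniform H e)))) eq) (proj₂ (position y∈′)))
        where
        position : ∀ {u} → u ∈ₛ edge H e → ∃ λ i → lookup (proj₁ (enumerate (edge H e) r (uniform H e))) i ≡ u
        position = proj₂ (proj₂ (proj₂ (enumerate (edge H e) r (uniform H e))))

    conflict-free : .{{_ : NonZero k}} → ∃ λ ω → Valid ω × Avoids 𝓑 ω
    conflict-free = extract (avoidable _∼?_ D {{m*n≢0 C (r ^ (q + p)) {{C≢0}} {{m^n≢0 r (q + p)}}}} 𝓑
        degree-≤ lopsided (∈-length (∈-Ω {rankMatrix} rankMatrix-valid)) ⊆-refl)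
      where
      -- Positivity of `k` enters here, to make `D` nonzero.
      C≢0 : NonZero C
      C≢0 = m*n≢0 (8 * p * p * k) (p ^ p) {{m*n≢0 (8 * p * p) k}} {{m^n≢0 p p}}
      extract : 0 < # (avoids? 𝓑) → ∃ λ ω → Valid ω × Avoids 𝓑 ω
      extract pos with filter (avoids? 𝓑) Ω in eq
      extract () | []
      ... | ω ∷ _ with ∈-filter⁻ (avoids? 𝓑) {xs = Ω} (subst (ω ∈_) (sym eq) (here refl))
      ...   | ω∈ , avoids = ω , Ω⇒Valid {ω} ω∈ , avoids

  -- From a conflict-free matrix to an equitable orientation

  orientation : ∀ ω → Valid ω → Orientation H
  orientation ω valid = record { σ = get ω ; inj = valid ; surj = surjective }
    where
    surjective : ∀ e j → ∃ λ x → x ∈ₛ edge H e × get ω e x ≡ j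
    surjective e j with FinP.any? (λ x → (x ∈? edge H e) ×-dec (get ω e x FinP.≟ j))
    ... | yes hit = hit
    -- Pigeonhole: a missed `j` together with the `r` distinct values on the edge would give `r + 1`
    -- distinct positions.
    ... | no miss = contradiction (begin-strict
        r                                             ≡⟨ sym (trans (length-map (get ω e) (elems (edge H e))) (trans (length-elems (edge H e)) (uniform H e))) ⟩
        length (map (get ω e) (elems (edge H e)))     <⟨ Unique⇒length≤ {ys = allFin r} (j∉ ∷ image!) (λ {y} _ → ∈-allFin y) ⟩
        length (allFin r)                             ≡⟨ length-allFin r ⟩
        r                                             ∎) (<-irrefl refl)
      where
      open ≤-Reasoning
      image! : Unique (map (get ω e) (elems (edge H e)))
      image! = Unique-map-on (get ω e) (λ x∈ y∈ → valid e _ _ (∈-elems⁻ (edge H e) x∈) (∈-elems⁻ (edge H e) y∈)) (elems! (edge H e))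
      j∉ : All (j ≢_) (map (get ω e) (elems (edge H e)))
      j∉ = All.tabulate λ y∈ j≡y → case ∈-map⁻ (get ω e) y∈ of λ
        (x , x∈ , y≡) → miss (x , ∈-elems⁻ (edge H e) x∈ , sym (trans j≡y y≡))

  -- Two different edges placing `U` on `P` would realise an event of `𝓑`: take for `x` a listing of
  -- `U`, for `a` its positions in `e`, and for `π` the matching given by equality of the images.
  deg-≤-1 : ∀ ω (valid : Valid ω) → Avoids 𝓑 ω → ∀ U P → ∣ U ∣ ≡ p → deg (orientation ω valid) U P ≤ 1
  deg-≤-1 ω valid avoids U P |U|≡p = ≤-trans (≤-reflexive (sym (length-filter-tabulate places? (λ e → e))))
    (Unique-subsingleton (Unique.filter⁺ places? (Unique.allFin⁺ (m H)))
      (λ e∈ f∈ → same (proj₂ (∈-filter⁻ places? {xs = allFin (m H)} e∈)) (proj₂ (∈-filter⁻ places? {xs = allFin (m H)} f∈))))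
    where
    Places : Fin (m H) → Set
    Places e = U ⊆ₛ edge H e × image (get ω e) U ≡ P
    places? : Decidable Places
    places? e = (U ⊆? edge H e) ×-dec VecP.≡-dec Data.Bool._≟_ (image (get ω e) U) P
    same : ∀ {e f} → Places e → Places f → e ≡ f
    same {e} {f} (U⊆e , imₑ) (U⊆f , im_f) with e FinP.≟ f | enumerate U p |U|≡p
    ... | yes e≡f | _ = e≡f
    ... | no e≢f | x , x-inj , x∈U , onto = contradiction filled
        (All.lookup avoids (∈-𝓑 {e , f , x , a , π} (e≢f , x-inj , (λ i → U⊆e (x∈U i)) , (λ i → U⊆f (x∈U i)))))
      where
      -- The position of the `i`-th vertex in `f` lies in the common image, so it is the position in
      -- `e` of some vertex of `U`; its index becomes `π i`.
      match : ∀ i → ∃ λ j → get ω e (lookup x j) ≡ get ω f (lookup x i)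
      match i with ∈-image⁻ (get ω e) (subst (get ω f (lookup x i) ∈ₛ_) (trans im_f (sym imₑ)) (∈-image⁺ (get ω f) (x∈U i)))
      ... | u , u∈U , eq with onto u∈U
      ...   | j , refl = j , eq
      a = tabulate (λ i → get ω e (lookup x i))
      π = tabulate (λ i → proj₁ (match i))
      a-lookup : ∀ i → lookup a i ≡ get ω e (lookup x i)
      a-lookup = VecP.lookup∘tabulate (λ i → get ω e (lookup x i))
      filled : Holds cells (e , f , x , a , π) ω
      filled = AllP.++⁺
        (AllP.map⁺ {xs = allFin p} (All.tabulate λ {i} _ → sym (a-lookup i)))
        (AllP.map⁺ {xs = allFin p} (All.tabulate λ {i} _ → sym (trans (cong (lookup a) (VecP.lookup∘tabulate (λ i → proj₁ (match i)) i))
          (trans (a-lookup _) (proj₂ (match i))))))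

  orientation-equitable : ∀ ω (valid : Valid ω) → Avoids 𝓑 ω → Equitable p (orientation ω valid)
  orientation-equitable ω valid avoids U P P′ |U|≡p _ _ = ≤-trans (∣m-n∣≤m⊔n d d′)
    (⊔-lub {1} {d} {d′} (deg-≤-1 ω valid avoids U P |U|≡p) (deg-≤-1 ω valid avoids U P′ |U|≡p))
    where
    d  = deg (orientation ω valid) U P
    d′ = deg (orientation ω valid) U P′

  equitable-orientation : .{{_ : NonZero k}} → 4 * C * 2 ^ (p + p) + 4 * p ≤ r → ∃ λ (O : Orientation H) → Equitable p O
  equitable-orientation large = let ω , valid , avoids = conflict-free large in
    orientation ω valid , orientation-equitable ω valid avoids

theorem1 : (p k : ℕ) → 1 ≤ p → 1 ≤ k →
    ∃ λ r₀ → ∀ (r : ℕ) → r ≥ r₀ → (H : Hypergraph r) → MaxDegLe H p k →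
    ∃ λ (O : Orientation H) → Equitable p O
-- The threshold is that of `large` with `C` written out, since it has to be named before `r` and
-- `H` are given.
theorem1 p@(suc q) k _ 1≤k = 4 * (8 * p * p * k * p ^ p) * 2 ^ (p + p) + 4 * p ,
  λ r large H maxdeg → Conflicts.equitable-orientation H q k maxdeg {{>-nonZero 1≤k}} large
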